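{- Let $A$ be a quantifier-free formula of $\mathbf{L}$ (i.e. a formula of $\mathbf{L_1}$). If $A$ is a theorem of $\mathbf{L}$, then $\vdash_H A$. That is, $\mathbf{L}$ is a conservative extension of the Hilbert-type $\mathbf{L_1}$.
   Context: Formulas of $\mathbf{L_1}$: built from atomic formulas $\epsilon ab$ ($a,b$ name variables, possibly equal) with primitive connectives $\vee,\sim$; $\wedge,\supset,\equiv$ defined as usual. $\vdash_H A$: $A$ belongs to the smallest set containing all instances of classical propositional tautologies and all formulas $\epsilon ab\supset\epsilon aa$, $(\epsilon ab\wedge\epsilon bc)\supset\epsilon ac$, $(\epsilon ab\wedge\epsilon bb)\supset\epsilon ba$, closed under modus ponens. Leśniewski's elementary ontology $\mathbf{L}$: the first-order theory (in classical first-order predicate logic without equality) whose language has the name variables as individual variables and a single binary predicate $\epsilon$, with the axiom (universal closure of) $\epsilon ab\equiv\big(\exists x(\epsilon xa\wedge\epsilon xb)\wedge\forall x\forall y(\epsilon xa\wedge\epsilon ya\supset\epsilon xy)\big)$. Formulas of $\mathbf{L_1}$ are exactly the quantifier-free formulas of $\mathbf{L}$. -}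

module Defs where

open import Data.Bool.Base as Bool using (Bool; true)
open import Data.Nat.Base using (ℕ; zero; suc)
open import Relation.Binary.PropositionalEquality using (_≡_)

record Connectives (F : Set) : Set where
  infix  8 ∼_
  infixr 7 _∧_
  infixr 6 _∨_
  infixr 5 _⊃_
  infix  4 _≣_
  field
    _∨_ : F → F → F
    ∼_  : F → F

  _∧_ : F → F → F
  A ∧ B = ∼ (∼ A ∨ ∼ B)

  _⊃_ : F → F → F
  A ⊃ B = ∼ A ∨ B

  _≣_ : F → F → F
  A ≣ B = (A ⊃ B) ∧ (B ⊃ A)

open Connectives ⦃ ... ⦄ public

instance
  boolConnectives : Connectives Bool
  boolConnectives = record { _∨_ = Bool._∨_ ; ∼_ = Bool.not }

data PropFormula : Set where
  letter : ℕ → PropFormula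
  disj   : PropFormula → PropFormula → PropFormula
  neg    : PropFormula → PropFormula

instance
  propConnectives : Connectives PropFormula
  propConnectives = record { _∨_ = disj ; ∼_ = neg }

-- For F = Bool this is the truth value under a valuation; for F a type of
-- formulas it is the instance obtained by substituting formulas for letters.
interpret : {F : Set} ⦃ _ : Connectives F ⦄ → (ℕ → F) → PropFormula → F
interpret s (letter p) = s p
interpret s (disj P Q) = interpret s P ∨ interpret s Q
interpret s (neg P)    = ∼ interpret s P

Tautology : PropFormula → Set
Tautology P = (v : ℕ → Bool) → interpret v P ≡ true

Name : Set
Name = ℕ

data L₁Formula : Set where
  ε    : Name → Name → L₁Formula
  disj : L₁Formula → L₁Formula → L₁Formula
  neg  : L₁Formula → L₁Formula

instance
  L₁Connectives : Connectives L₁Formula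
  L₁Connectives = record { _∨_ = disj ; ∼_ = neg }

infix 3 ⊢H_

data ⊢H_ : L₁Formula → Set where
  taut : (P : PropFormula) (s : ℕ → L₁Formula) → Tautology P → ⊢H interpret s P
  ax₁  : (a b : Name) → ⊢H ε a b ⊃ ε a a
  ax₂  : (a b c : Name) → ⊢H (ε a b ∧ ε b c) ⊃ ε a c
  ax₃  : (a b : Name) → ⊢H (ε a b ∧ ε b b) ⊃ ε b a
  mp   : {A B : L₁Formula} → ⊢H A ⊃ B → ⊢H A → ⊢H B

-- De Bruijn indices: under k quantifiers, index i < k is bound, and index k + n
-- denotes the name variable n.
data LFormula : Set where
  ε    : Name → Name → LFormula
  disj : LFormula → LFormula → LFormula
  neg  : LFormula → LFormula
  all  : LFormula → LFormula

instance
  LConnectives : Connectives LFormula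
  LConnectives = record { _∨_ = disj ; ∼_ = neg }

ex : LFormula → LFormula
ex A = ∼ all (∼ A)

lift : (Name → Name) → Name → Name
lift ρ zero    = zero
lift ρ (suc n) = suc (ρ n)

rename : (Name → Name) → LFormula → LFormula
rename ρ (ε a b)    = ε (ρ a) (ρ b)
rename ρ (disj A B) = disj (rename ρ A) (rename ρ B)
rename ρ (neg A)    = neg (rename ρ A)
rename ρ (all A)    = all (rename (lift ρ) A)

weaken : LFormula → LFormula
weaken = rename suc

instantiate : Name → Name → Name
instantiate a zero    = a
instantiate a (suc n) = n

-- The matrix A of a quantified formula all A, with the name variable a
-- substituted for the bound variable; the only terms are variables.
_[_] : LFormula → Name → LFormula
A [ a ] = rename (instantiate a) A

-- ∀a ∀b (εab ≡ (∃x (εxa ∧ εxb) ∧ ∀x ∀y (εxa ∧ εya ⊃ εxy)))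
ontologyAxiom : LFormula
ontologyAxiom =
  all (all (ε 1 0 ≣ ( ex (ε 0 2 ∧ ε 0 1)
                    ∧ all (all ((ε 1 3 ∧ ε 0 3) ⊃ ε 1 0)))))

infix 3 ⊢L_

-- Hilbert-style classical predicate calculus. In all-⊃ the weakening of A
-- expresses that the quantified variable is not free in A.
data ⊢L_ : LFormula → Set where
  taut     : (P : PropFormula) (s : ℕ → LFormula) → Tautology P → ⊢L interpret s P
  all-elim : (A : LFormula) (a : Name) → ⊢L all A ⊃ A [ a ]
  all-⊃    : (A B : LFormula) → ⊢L all (weaken A ⊃ B) ⊃ (A ⊃ all B)
  ontology : ⊢L ontologyAxiom
  mp       : {A B : LFormula} → ⊢L A ⊃ B → ⊢L A → ⊢L B
  gen      : {A : LFormula} → ⊢L A → ⊢L all A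

-- The identification of L₁-formulas with the quantifier-free formulas of L.
embed : L₁Formula → LFormula
embed (ε a b)    = ε a b
embed (disj A B) = disj (embed A) (embed B)
embed (neg A)    = neg (embed A)

{-# OPTIONS --safe #-}
-- A quantifier-free theorem A of L holds in every structure for the Hilbert axioms,
-- because such a structure, once restricted to the finitely many names of A,
-- extends to a model of L: add two individuals, distinct from each other and from
-- the old ones, that belong to precisely those old names a for which εaa fails.
-- Such an a then has two distinct members, so the right-hand side of the ontology
-- axiom fails for it, and for the other names the axiom follows from the three
-- Hilbert axioms.  Hence A is a propositional consequence of the finitely many
-- instances of the Hilbert axioms in the names of A.
module Submission where

open import Data.Bool.Base using (Bool; true; false; not)
open import Data.Bool.Properties using (_≟_; not-¬)
open import Data.Fin.Base using (Fin; zero; suc; toℕ)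
open import Data.Fin.Properties using (all?; toℕ<n; toℕ-fromℕ<)
open import Data.Nat.Base using (ℕ; zero; suc; _+_; _*_; _⊔_; _≤_; _<_; s≤s)
open import Data.Nat.DivMod using (_/_; _%_; _mod_; m<n⇒m%n≡m; m<n⇒m/n≡0; m*n/n≡m; [m+kn]%n≡m%n; +-distrib-/-∣ʳ; m%n<n)
open import Data.Nat.Divisibility using (n∣m*n)
open import Data.Nat.Properties using (≤-trans; ≤-refl; m≤m⊔n; m≤n⊔m)
open import Data.Product.Base using (_×_; _,_; proj₁; proj₂; ∃₂)
open import Data.Vec.Base using (Vec; []; _∷_)
open import Function.Base using (_∘_)
open import Relation.Binary.PropositionalEquality using (_≡_; refl; sym; trans; cong; cong₂; subst; module ≡-Reasoning)
open import Relation.Nullary.Decidable using (does; proof; dec-true)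
open import Relation.Nullary.Reflects using (Reflects; invert)
open import Relation.Nullary.Negation using (contradiction)
open import Defs

-- Truth values

⊃-intro : ∀ a {b : Bool} → (a ≡ true → b ≡ true) → (a ⊃ b) ≡ true
⊃-intro true  h = h refl
⊃-intro false h = refl

⊃-elim : ∀ a {b : Bool} → (a ⊃ b) ≡ true → a ≡ true → b ≡ true
⊃-elim true h refl = h

∧-intro : ∀ {a b : Bool} → a ≡ true → b ≡ true → (a ∧ b) ≡ true
∧-intro refl refl = refl

∧-elim : ∀ a b → (a ∧ b) ≡ true → a ≡ true × b ≡ true
∧-elim true true h = refl , refl

-- Quantification over a finite set is decidable, so quantified formulas can take values in `Bool`
-- like all others.
∀ᵇ : ∀ {n} → (Fin n → Bool) → Bool
∀ᵇ f = does (all? λ i → f i ≟ true)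

∀ᵇ-intro : ∀ {n} (f : Fin n → Bool) → (∀ i → f i ≡ true) → ∀ᵇ f ≡ true
∀ᵇ-intro f = dec-true (all? λ i → f i ≟ true)

∀ᵇ-elim : ∀ {n} (f : Fin n → Bool) → ∀ᵇ f ≡ true → ∀ i → f i ≡ true
∀ᵇ-elim f h = invert (subst (Reflects _) h (proof (all? λ i → f i ≟ true)))

-- Takes the place of function extensionality in the quantifier case of `eval-rename`.
∀ᵇ-cong : ∀ {n} {f g : Fin n → Bool} → (∀ i → f i ≡ g i) → ∀ᵇ f ≡ ∀ᵇ g
∀ᵇ-cong {_} {f} {g} f≡g with ∀ᵇ f in eq
... | true  = sym (∀ᵇ-intro g λ i → trans (sym (f≡g i)) (∀ᵇ-elim f eq i))
... | false with ∀ᵇ g in eq′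
...   | false = refl
...   | true  = trans (sym eq) (∀ᵇ-intro f λ i → trans (f≡g i) (∀ᵇ-elim g eq′ i))

∃ᵇ-intro : ∀ {n} (f : Fin n → Bool) i → f i ≡ true → ∼ ∀ᵇ (∼_ ∘ f) ≡ true
∃ᵇ-intro f i h with ∀ᵇ (∼_ ∘ f) in eq
... | false = refl
... | true  = contradiction (∀ᵇ-elim (∼_ ∘ f) eq i) (not-¬ (cong not h))

∃ᵇ-elim : ∀ {n} (f : Fin n → Bool) b → (∀ i → f i ≡ true → b ≡ true) → ∼ ∀ᵇ (∼_ ∘ f) ≡ true → b ≡ true
∃ᵇ-elim f true  h e = refl
∃ᵇ-elim f false h e = contradiction e (not-¬ (cong not (∀ᵇ-intro (∼_ ∘ f) all-false)))
  where
  all-false : ∀ i → ∼ f i ≡ true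
  all-false i with f i in eq
  ... | false = refl
  ... | true  = h i eq

-- Tautologies by truth tables

everywhere : ∀ {n} → (Vec Bool n → Bool) → Bool
everywhere {zero}  f = f []
everywhere {suc n} f = everywhere (f ∘ (true ∷_)) ∧ everywhere (f ∘ (false ∷_))

everywhere-elim : ∀ {n} (f : Vec Bool n → Bool) → everywhere f ≡ true → ∀ bs → f bs ≡ true
everywhere-elim f h []           = h
everywhere-elim f h (true ∷ bs)  = everywhere-elim _ (proj₁ (∧-elim (everywhere (f ∘ (true ∷_))) _ h)) bs
everywhere-elim f h (false ∷ bs) = everywhere-elim _ (proj₂ (∧-elim (everywhere (f ∘ (true ∷_))) _ h)) bs

-- Past the end the last entry is repeated.
at : ∀ {X : Set} {n} → Vec X (suc n) → ℕ → X
at (x ∷ _)      zero    = x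
at (x ∷ [])     (suc k) = x
at (x ∷ y ∷ ys) (suc k) = at (y ∷ ys) k

-- For a concrete `P` the hypothesis computes to `refl`. With `bs` listing `v 0`, `v 1` and so on,
-- up to the last letter of `P`, the conclusion is by computation the statement for the valuation
-- `v`.
truth-table : ∀ {n} (P : PropFormula) → everywhere {suc n} (λ bs → interpret (at bs) P) ≡ true →
              (bs : Vec Bool (suc n)) → interpret (at bs) P ≡ true
truth-table P = everywhere-elim (λ bs → interpret (at bs) P)

p q r s t : PropFormula
p = letter 0
q = letter 1
r = letter 2
s = letter 3
t = letter 4

-- The Hilbert axioms as theorems of L

contrapositive : ∀ A B → ⊢L A ⊃ B → ⊢L ∼ B ⊃ ∼ A
contrapositive A B = mp (taut P (at (A ∷ B ∷ [])) λ v → truth-table P refl (v 0 ∷ v 1 ∷ []))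
  where P = (p ⊃ q) ⊃ (∼ q ⊃ ∼ p)

swap-∼ : ∀ A B → ⊢L A ⊃ ∼ B → ⊢L B ⊃ ∼ A
swap-∼ A B = mp (taut P (at (A ∷ B ∷ [])) λ v → truth-table P refl (v 0 ∷ v 1 ∷ []))
  where P = (p ⊃ ∼ q) ⊃ (q ⊃ ∼ p)

∼-swap : ∀ A B → ⊢L ∼ A ⊃ B → ⊢L ∼ B ⊃ A
∼-swap A B = mp (taut P (at (A ∷ B ∷ [])) λ v → truth-table P refl (v 0 ∷ v 1 ∷ []))
  where P = (∼ p ⊃ q) ⊃ (∼ q ⊃ p)

⊃-trans : ∀ A B C → ⊢L A ⊃ B → ⊢L B ⊃ C → ⊢L A ⊃ C
⊃-trans A B C d e = mp (mp (taut P (at (A ∷ B ∷ C ∷ [])) λ v → truth-table P refl (v 0 ∷ v 1 ∷ v 2 ∷ [])) d) e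
  where P = (p ⊃ q) ⊃ (q ⊃ r) ⊃ (p ⊃ r)

ex-intro : ∀ A a → ⊢L A [ a ] ⊃ ex A
ex-intro A a = swap-∼ (all (∼ A)) (A [ a ]) (all-elim (∼ A) a)

ex-elim : ∀ A B → ⊢L A ⊃ weaken B → ⊢L ex A ⊃ B
ex-elim A B d = ∼-swap B (all (∼ A)) (mp (all-⊃ (∼ B) (∼ A)) (gen (contrapositive A (weaken B) d)))

-- `common a b` and `atMostOne a` are the two conjuncts on the right of the ontology axiom; each
-- enclosing quantifier shifts the free names by one.
common : Name → Name → LFormula
common a b = ex (ε 0 (suc a) ∧ ε 0 (suc b))

atMostOne : Name → LFormula
atMostOne a = all (all ((ε 1 (2 + a) ∧ ε 0 (2 + a)) ⊃ ε 1 0))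

ontology-instance : ∀ a b → ⊢L ε a b ≣ (common a b ∧ atMostOne a)
ontology-instance a b = mp (all-elim _ b) (mp (all-elim _ a) ontology)

ε⇒common : ∀ a b → ⊢L ε a b ⊃ common a b
ε⇒common a b = mp (taut P (at (ε a b ∷ common a b ∷ atMostOne a ∷ [])) λ v → truth-table P refl (v 0 ∷ v 1 ∷ v 2 ∷ [])) (ontology-instance a b)
  where P = (p ≣ (q ∧ r)) ⊃ (p ⊃ q)

ε⇒atMostOne : ∀ a b → ⊢L ε a b ⊃ atMostOne a
ε⇒atMostOne a b = mp (taut P (at (ε a b ∷ common a b ∷ atMostOne a ∷ [])) λ v → truth-table P refl (v 0 ∷ v 1 ∷ v 2 ∷ [])) (ontology-instance a b)
  where P = (p ≣ (q ∧ r)) ⊃ (p ⊃ r)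

common⇒ε : ∀ a b → ⊢L common a b ⊃ (atMostOne a ⊃ ε a b)
common⇒ε a b = mp (taut P (at (ε a b ∷ common a b ∷ atMostOne a ∷ [])) λ v → truth-table P refl (v 0 ∷ v 1 ∷ v 2 ∷ [])) (ontology-instance a b)
  where P = (p ≣ (q ∧ r)) ⊃ (q ⊃ (r ⊃ p))

common-refl : ∀ a b → ⊢L common a b ⊃ common a a
common-refl a b = ex-elim (ε 0 (suc a) ∧ ε 0 (suc b)) (common a a)
  (⊃-trans _ (ε 0 (suc a) ∧ ε 0 (suc a)) _
    (taut P (at (ε 0 (suc a) ∷ ε 0 (suc b) ∷ [])) λ v → truth-table P refl (v 0 ∷ v 1 ∷ []))
    -- The witness is the variable released by `ex-elim`, which has index 0; below it and the new
    -- quantifier, `a` has become `2 + a`.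
    (ex-intro (ε 0 (2 + a) ∧ ε 0 (2 + a)) 0))
  where P = (p ∧ q) ⊃ (p ∧ p)

common-sym : ∀ a b → ⊢L common a b ⊃ common b a
common-sym a b = ex-elim (ε 0 (suc a) ∧ ε 0 (suc b)) (common b a)
  (⊃-trans _ (ε 0 (suc b) ∧ ε 0 (suc a)) _
    (taut P (at (ε 0 (suc a) ∷ ε 0 (suc b) ∷ [])) λ v → truth-table P refl (v 0 ∷ v 1 ∷ []))
    (ex-intro (ε 0 (2 + b) ∧ ε 0 (2 + a)) 0))
  where P = (p ∧ q) ⊃ (q ∧ p)

atMostOne-elim : ∀ c a b → ⊢L atMostOne c ⊃ ((ε a c ∧ ε b c) ⊃ ε a b)
atMostOne-elim c a b = ⊃-trans _ (all ((ε (suc a) (suc c) ∧ ε 0 (suc c)) ⊃ ε (suc a) 0)) _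
  (all-elim (all ((ε 1 (2 + c) ∧ ε 0 (2 + c)) ⊃ ε 1 0)) a)
  (all-elim ((ε (suc a) (suc c) ∧ ε 0 (suc c)) ⊃ ε (suc a) 0) b)

-- A common member of b and c is a member of a, both being members of b.
common-transport : ∀ a b c → ⊢L common b c ⊃ ((ε a b ∧ atMostOne b) ⊃ common a c)
common-transport a b c = ex-elim (ε 0 (suc b) ∧ ε 0 (suc c)) ((ε a b ∧ atMostOne b) ⊃ common a c)
  (mp (mp (taut P (at As) λ v → truth-table P refl (v 0 ∷ v 1 ∷ v 2 ∷ v 3 ∷ v 4 ∷ v 5 ∷ []))
    (atMostOne-elim (suc b) 0 (suc a)))
    (ex-intro (ε 0 (2 + a) ∧ ε 0 (2 + c)) 0))
  where
  As = ε 0 (suc b) ∷ ε 0 (suc c) ∷ ε (suc a) (suc b) ∷ atMostOne (suc b) ∷ ε 0 (suc a) ∷ common (suc a) (suc c) ∷ []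
  P = (s ⊃ ((p ∧ r) ⊃ t)) ⊃ ((t ∧ q) ⊃ letter 5) ⊃ ((p ∧ q) ⊃ ((r ∧ s) ⊃ letter 5))

L-ax₁ : ∀ a b → ⊢L ε a b ⊃ ε a a
L-ax₁ a b = mp (mp (mp (mp (taut P (at As) λ v → truth-table P refl (v 0 ∷ v 1 ∷ v 2 ∷ v 3 ∷ v 4 ∷ []))
  (ε⇒common a b)) (ε⇒atMostOne a b)) (common-refl a b)) (common⇒ε a a)
  where
  As = ε a b ∷ common a b ∷ atMostOne a ∷ common a a ∷ ε a a ∷ []
  P = (p ⊃ q) ⊃ (p ⊃ r) ⊃ (q ⊃ s) ⊃ (s ⊃ (r ⊃ t)) ⊃ (p ⊃ t)

-- From `ε b c` come a common member of `b` and `c` and the uniqueness for `b`, which with `ε a b`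
-- make that member common to `a` and `c`; uniqueness for `a` comes from `ε a b`.
L-ax₂ : ∀ a b c → ⊢L (ε a b ∧ ε b c) ⊃ ε a c
L-ax₂ a b c = mp (mp (mp (mp (mp (taut P (at As) λ v → truth-table P refl (v 0 ∷ v 1 ∷ v 2 ∷ v 3 ∷ v 4 ∷ v 5 ∷ v 6 ∷ []))
  (ε⇒atMostOne a b)) (ε⇒common b c)) (ε⇒atMostOne b c)) (common-transport a b c)) (common⇒ε a c)
  where
  As = ε a b ∷ ε b c ∷ atMostOne a ∷ common b c ∷ atMostOne b ∷ common a c ∷ ε a c ∷ []
  P = (p ⊃ r) ⊃ (q ⊃ s) ⊃ (q ⊃ t) ⊃ (s ⊃ ((p ∧ t) ⊃ letter 5)) ⊃ (letter 5 ⊃ (r ⊃ letter 6)) ⊃ ((p ∧ q) ⊃ letter 6)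

L-ax₃ : ∀ a b → ⊢L (ε a b ∧ ε b b) ⊃ ε b a
L-ax₃ a b = mp (mp (mp (mp (taut P (at As) λ v → truth-table P refl (v 0 ∷ v 1 ∷ v 2 ∷ v 3 ∷ v 4 ∷ v 5 ∷ []))
  (ε⇒common a b)) (ε⇒atMostOne b b)) (common-sym a b)) (common⇒ε b a)
  where
  As = ε a b ∷ ε b b ∷ common a b ∷ atMostOne b ∷ common b a ∷ ε b a ∷ []
  P = (p ⊃ r) ⊃ (q ⊃ s) ⊃ (r ⊃ t) ⊃ (t ⊃ (s ⊃ letter 5)) ⊃ ((p ∧ q) ⊃ letter 5)

embed-interpret : ∀ σ P → embed (interpret σ P) ≡ interpret (embed ∘ σ) P
embed-interpret σ (letter k) = refl
embed-interpret σ (disj P Q) = cong₂ disj (embed-interpret σ P) (embed-interpret σ Q)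
embed-interpret σ (neg P)    = cong neg (embed-interpret σ P)

H⇒L : ∀ {A} → ⊢H A → ⊢L embed A
H⇒L (taut P σ h) = subst ⊢L_ (sym (embed-interpret σ P)) (taut P (embed ∘ σ) h)
H⇒L (ax₁ a b)    = L-ax₁ a b
H⇒L (ax₂ a b c)  = L-ax₂ a b c
H⇒L (ax₃ a b)    = L-ax₃ a b
H⇒L (mp d e)     = mp (H⇒L d) (H⇒L e)

-- Finite models of L

record IsL₁Model {X : Set} (_∈_ : X → X → Bool) : Set where
  field
    ∈-individual : ∀ {x y} → x ∈ y ≡ true → x ∈ x ≡ true
    ∈-trans      : ∀ {x y z} → x ∈ y ≡ true → y ∈ z ≡ true → x ∈ z ≡ true
    ∈-sym        : ∀ {x y} → x ∈ y ≡ true → y ∈ y ≡ true → y ∈ x ≡ true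

open IsL₁Model

_∙_ : {X : Set} → X → (Name → X) → Name → X
(x ∙ ρ) zero    = x
(x ∙ ρ) (suc a) = ρ a

module _ {n} (_∈_ : Fin n → Fin n → Bool) where

  eval : (Name → Fin n) → LFormula → Bool
  eval ρ (ε a b)    = ρ a ∈ ρ b
  eval ρ (disj A B) = eval ρ A ∨ eval ρ B
  eval ρ (neg A)    = ∼ eval ρ A
  eval ρ (all A)    = ∀ᵇ λ x → eval (x ∙ ρ) A

  -- Stated for arbitrary renamings, this covers both the instantiation in `all-elim` and the
  -- weakening in `all-⊃`.
  eval-rename : ∀ A {ρ ρ′} σ → (∀ a → ρ (σ a) ≡ ρ′ a) → eval ρ (rename σ A) ≡ eval ρ′ A
  eval-rename (ε a b)    σ h = cong₂ _∈_ (h a) (h b)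
  eval-rename (disj A B) σ h = cong₂ _∨_ (eval-rename A σ h) (eval-rename B σ h)
  eval-rename (neg A)    σ h = cong ∼_ (eval-rename A σ h)
  eval-rename (all A)    σ h = ∀ᵇ-cong {n} λ x → eval-rename A (lift σ) λ { zero → refl ; (suc a) → h a }

  eval-interpret : ∀ ρ σ P → eval ρ (interpret σ P) ≡ interpret (eval ρ ∘ σ) P
  eval-interpret ρ σ (letter k) = refl
  eval-interpret ρ σ (disj P Q) = cong₂ _∨_ (eval-interpret ρ σ P) (eval-interpret ρ σ Q)
  eval-interpret ρ σ (neg P)    = cong ∼_ (eval-interpret ρ σ P)

  module _ (isL₁Model : IsL₁Model _∈_)
           (split : ∀ x → x ∈ x ≡ false → ∃₂ λ y z → y ∈ x ≡ true × z ∈ x ≡ true × y ∈ z ≡ false) where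

    open IsL₁Model isL₁Model renaming (∈-individual to ind; ∈-trans to tr; ∈-sym to sy)

    -- Forwards, `x` is itself the common member, and members `z`, `w` of the individual `x` satisfy
    -- `z ∈ x` and `x ∈ w`. Backwards, uniqueness makes `x` an individual, so a common member `z`
    -- gives `x ∈ z` and `z ∈ y`.
    ontology-valid : ∀ ρ → eval ρ ontologyAxiom ≡ true
    ontology-valid ρ = ∀ᵇ-intro _ λ x → ∀ᵇ-intro _ λ y →
      ∧-intro (⊃-intro (x ∈ y) λ x∈y → ∧-intro
                (∃ᵇ-intro (λ z → z ∈ x ∧ z ∈ y) x (∧-intro (ind x∈y) x∈y))
                (∀ᵇ-intro _ λ z → ∀ᵇ-intro _ λ w → ⊃-intro (z ∈ x ∧ w ∈ x) λ h →
                  let z∈x , w∈x = ∧-elim (z ∈ x) (w ∈ x) h in tr z∈x (sy w∈x (ind x∈y))))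
              (⊃-intro (commonᵇ x y ∧ uniqueᵇ x) λ h →
                let e , u = ∧-elim (commonᵇ x y) (uniqueᵇ x) h in
                ∃ᵇ-elim (λ z → z ∈ x ∧ z ∈ y) (x ∈ y)
                  (λ z h → let z∈x , z∈y = ∧-elim (z ∈ x) (z ∈ y) h in tr (sy z∈x (individual x u)) z∈y)
                  e)
      where
      commonᵇ : Fin n → Fin n → Bool
      commonᵇ x y = ∼ ∀ᵇ λ z → ∼ (z ∈ x ∧ z ∈ y)

      uniqueᵇ : Fin n → Bool
      uniqueᵇ x = ∀ᵇ λ z → ∀ᵇ λ w → (z ∈ x ∧ w ∈ x) ⊃ z ∈ w

      -- Were `x ∈ x` false, `split` would give two members of `x` that violate uniqueness.
      individual : ∀ x → uniqueᵇ x ≡ true → x ∈ x ≡ true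
      individual x u with x ∈ x in eq
      ... | true  = refl
      ... | false =
        let z , w , z∈x , w∈x , z∉w = split x eq
        in trans (sym z∉w) (⊃-elim (z ∈ x ∧ w ∈ x) (∀ᵇ-elim _ (∀ᵇ-elim _ u z) w) (∧-intro z∈x w∈x))

    sound : ∀ {A} → ⊢L A → ∀ ρ → eval ρ A ≡ true
    sound (taut P σ h)   ρ = trans (eval-interpret ρ σ P) (h (eval ρ ∘ σ))
    sound (all-elim A a) ρ = ⊃-intro (eval ρ (all A)) λ h →
      trans (eval-rename A (instantiate a) λ { zero → refl ; (suc b) → refl }) (∀ᵇ-elim _ h (ρ a))
    sound (all-⊃ A B)    ρ = ⊃-intro (eval ρ (all (weaken A ⊃ B))) λ h → ⊃-intro (eval ρ A) λ k →
      ∀ᵇ-intro _ λ x → ⊃-elim (eval (x ∙ ρ) (weaken A)) (∀ᵇ-elim _ h x)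
                         (trans (eval-rename A suc λ _ → refl) k)
    sound ontology       ρ = ontology-valid ρ
    sound (mp {A} d e)   ρ = ⊃-elim (eval ρ A) (sound d ρ) (sound e ρ)
    sound (gen d)        ρ = ∀ᵇ-intro _ λ x → sound d (x ∙ ρ)

-- The points 0 and 1 are the new individuals.
extend : ∀ {n} → (Fin n → Fin n → Bool) → Fin (2 + n) → Fin (2 + n) → Bool
extend _∈_ zero          zero          = true
extend _∈_ (suc zero)    (suc zero)    = true
extend _∈_ zero          (suc (suc x)) = not (x ∈ x)
extend _∈_ (suc zero)    (suc (suc x)) = not (x ∈ x)
extend _∈_ (suc (suc x)) (suc (suc y)) = x ∈ y
extend _∈_ _             _             = false

-- The new points are individuals, so `x` is old; both new points then belong to it, and neither
-- belongs to the other.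
extend-split : ∀ {n} (_∈_ : Fin n → Fin n → Bool) → let _∈⁺_ = extend _∈_ in
               ∀ x → x ∈⁺ x ≡ false → ∃₂ λ y z → y ∈⁺ x ≡ true × z ∈⁺ x ≡ true × y ∈⁺ z ≡ false
extend-split _∈_ (suc (suc x)) x∉x = zero , suc zero , cong not x∉x , cong not x∉x , refl

not-both : ∀ {b} {X : Set} → not b ≡ true → b ≡ true → X
not-both {true}  () _
not-both {false} _  ()

-- No old point belongs to a new one. If a new point belongs to an old `y`, then `y ∈ y` fails, so
-- `y` belongs to nothing old; this refutes the mixed cases.
extend-isL₁Model : ∀ {n} {_∈_ : Fin n → Fin n → Bool} → IsL₁Model _∈_ → IsL₁Model (extend _∈_)
extend-isL₁Model {_∈_ = _∈_} M = record
  { ∈-individual = λ {x} {y} → ind x y ; ∈-trans = λ {x} {y} {z} → tr x y z ; ∈-sym = λ {x} {y} → sy x y }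
  where
  _∈⁺_ = extend _∈_

  ind : ∀ x y → x ∈⁺ y ≡ true → x ∈⁺ x ≡ true
  ind zero          y             h = refl
  ind (suc zero)    y             h = refl
  ind (suc (suc x)) (suc (suc y)) h = ∈-individual M h

  tr : ∀ x y z → x ∈⁺ y ≡ true → y ∈⁺ z ≡ true → x ∈⁺ z ≡ true
  tr zero          zero          z             h k = k
  tr (suc zero)    (suc zero)    z             h k = k
  tr zero          (suc (suc y)) (suc (suc z)) h k = not-both h (∈-individual M k)
  tr (suc zero)    (suc (suc y)) (suc (suc z)) h k = not-both h (∈-individual M k)
  tr (suc (suc x)) (suc (suc y)) (suc (suc z)) h k = ∈-trans M h k

  sy : ∀ x y → x ∈⁺ y ≡ true → y ∈⁺ y ≡ true → y ∈⁺ x ≡ true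
  sy zero          zero          h k = refl
  sy (suc zero)    (suc zero)    h k = refl
  sy zero          (suc (suc y)) h k = not-both h k
  sy (suc zero)    (suc (suc y)) h k = not-both h k
  sy (suc (suc x)) (suc (suc y)) h k = ∈-sym M h k

-- Propositional consequences of the Hilbert axioms

AllNames : (Name → Set) → L₁Formula → Set
AllNames P (ε a b)    = P a × P b
AllNames P (disj A B) = AllNames P A × AllNames P B
AllNames P (neg A)    = AllNames P A

nameBound : L₁Formula → ℕ
nameBound (ε a b)    = a ⊔ b
nameBound (disj A B) = nameBound A ⊔ nameBound B
nameBound (neg A)    = nameBound A

nameBound-bounds : ∀ A {m} → nameBound A ≤ m → AllNames (_< suc m) A
nameBound-bounds (ε a b)    h = s≤s (≤-trans (m≤m⊔n a b) h) , s≤s (≤-trans (m≤n⊔m a b) h)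
nameBound-bounds (disj A B) h = nameBound-bounds A (≤-trans (m≤m⊔n (nameBound A) _) h) ,
                                nameBound-bounds B (≤-trans (m≤n⊔m (nameBound A) _) h)
nameBound-bounds (neg A)    h = nameBound-bounds A h

eval₁ : (Name → Name → Bool) → L₁Formula → Bool
eval₁ R (ε a b)    = R a b
eval₁ R (disj A B) = eval₁ R A ∨ eval₁ R B
eval₁ R (neg A)    = ∼ eval₁ R A

∧-introH : ∀ A B → ⊢H A → ⊢H B → ⊢H A ∧ B
∧-introH A B d e = mp (mp (taut P (at (A ∷ B ∷ [])) λ v → truth-table P refl (v 0 ∷ v 1 ∷ [])) d) e
  where P = p ⊃ q ⊃ (p ∧ q)

-- The index set is nonempty because the language has no constant for the empty conjunction.
⋀ : ∀ {m} → (Fin (suc m) → L₁Formula) → L₁Formula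
⋀ {zero}  f = f zero
⋀ {suc m} f = f zero ∧ ⋀ (f ∘ suc)

⋀-AllNames : ∀ {P m} (f : Fin (suc m) → L₁Formula) → (∀ i → AllNames P (f i)) → AllNames P (⋀ f)
⋀-AllNames {m = zero}  f h = h zero
⋀-AllNames {m = suc m} f h = h zero , ⋀-AllNames (f ∘ suc) (h ∘ suc)

⋀-intro : ∀ {m} (f : Fin (suc m) → L₁Formula) → (∀ i → ⊢H f i) → ⊢H ⋀ f
⋀-intro {zero}  f h = h zero
⋀-intro {suc m} f h = ∧-introH _ _ (h zero) (⋀-intro (f ∘ suc) (h ∘ suc))

⋀-eval : ∀ R {m} (f : Fin (suc m) → L₁Formula) → eval₁ R (⋀ f) ≡ true → ∀ i → eval₁ R (f i) ≡ true
⋀-eval R {zero}  f h zero    = h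
⋀-eval R {suc m} f h zero    = proj₁ (∧-elim (eval₁ R (f zero)) _ h)
⋀-eval R {suc m} f h (suc i) = ⋀-eval R (f ∘ suc) (proj₂ (∧-elim (eval₁ R (f zero)) _ h)) i

axioms : Name → Name → Name → L₁Formula
axioms a b c = (ε a b ⊃ ε a a) ∧ ((ε a b ∧ ε b c) ⊃ ε a c) ∧ ((ε a b ∧ ε b b) ⊃ ε b a)

-- Reduction to the names below `suc m`

module _ (m : ℕ) where

  -- The pair of `a` and `b` is coded as a two-digit number in base `suc m`, which `atom` decodes by
  -- quotient and remainder.
  letterise : L₁Formula → PropFormula
  letterise (ε a b)    = letter (b + a * suc m)
  letterise (disj A B) = letterise A ∨ letterise B
  letterise (neg A)    = ∼ letterise A

  atom : ℕ → L₁Formula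
  atom k = ε (k / suc m) (k % suc m)

  interpret-letterise : ∀ A → AllNames (_< suc m) A → interpret atom (letterise A) ≡ A
  interpret-letterise (ε a b) (_ , b<n) = cong₂ ε quotient remainder
    where
    open ≡-Reasoning
    quotient : (b + a * suc m) / suc m ≡ a
    quotient = begin
      (b + a * suc m) / suc m          ≡⟨ +-distrib-/-∣ʳ b (n∣m*n a) ⟩
      b / suc m + (a * suc m) / suc m  ≡⟨ cong₂ _+_ (m<n⇒m/n≡0 b<n) (m*n/n≡m a (suc m)) ⟩
      a                                ∎
    remainder : (b + a * suc m) % suc m ≡ b
    remainder = trans ([m+kn]%n≡m%n b a (suc m)) (m<n⇒m%n≡m b<n)
  interpret-letterise (disj A B) (h , k) = cong₂ disj (interpret-letterise A h) (interpret-letterise B k)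
  interpret-letterise (neg A)    h       = cong neg (interpret-letterise A h)

  eval-letterise : ∀ v A → interpret v (letterise A) ≡ eval₁ (λ a b → v (b + a * suc m)) A
  eval-letterise v (ε a b)    = refl
  eval-letterise v (disj A B) = cong₂ _∨_ (eval-letterise v A) (eval-letterise v B)
  eval-letterise v (neg A)    = cong ∼_ (eval-letterise v A)

  -- A valuation of the letters is a relation on names read through the coding, so `letterise A` is
  -- a tautology and `A` an instance of it.
  valid⇒H : ∀ A → AllNames (_< suc m) A → (∀ R → eval₁ R A ≡ true) → ⊢H A
  valid⇒H A h valid = subst ⊢H_ (interpret-letterise A h)
    (taut (letterise A) atom λ v → trans (eval-letterise v A) (valid _))

  theory : L₁Formula
  theory = ⋀ {m} λ i → ⋀ {m} λ j → ⋀ {m} λ k → axioms (toℕ i) (toℕ j) (toℕ k)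

  theory-AllNames : AllNames (_< suc m) theory
  theory-AllNames = ⋀-AllNames {_< suc m} {m} _ λ i → ⋀-AllNames {_< suc m} {m} _ λ j → ⋀-AllNames {_< suc m} {m} _ λ k →
    let a = toℕ<n i ; b = toℕ<n j ; c = toℕ<n k in
    ((a , b) , (a , a)) , ((((a , b) , (b , c)) , (a , c)) , (((a , b) , (b , b)) , (b , a)))

  theory-provable : ⊢H theory
  theory-provable = ⋀-intro {m} _ λ i → ⋀-intro {m} _ λ j → ⋀-intro {m} _ λ k →
    ∧-introH _ _ (ax₁ (toℕ i) (toℕ j)) (∧-introH _ _ (ax₂ (toℕ i) (toℕ j) (toℕ k)) (ax₃ (toℕ i) (toℕ j)))

  restrict : (Name → Name → Bool) → Fin (suc m) → Fin (suc m) → Bool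
  restrict R i j = R (toℕ i) (toℕ j)

  theory-model : ∀ R → eval₁ R theory ≡ true → IsL₁Model (restrict R)
  theory-model R h = record
    -- `axioms` takes three names; where an axiom mentions only two, the third argument is filled
    -- with `i`.
    { ∈-individual = λ {i} {j} i∈j → ⊃-elim (i ∈ j) (proj₁ (at-names i j i)) i∈j
    ; ∈-trans      = λ {i} {j} {k} i∈j j∈k → ⊃-elim (i ∈ j ∧ j ∈ k) (proj₁ (proj₂ (at-names i j k))) (∧-intro i∈j j∈k)
    ; ∈-sym        = λ {i} {j} i∈j j∈j → ⊃-elim (i ∈ j ∧ j ∈ j) (proj₂ (proj₂ (at-names i j i))) (∧-intro i∈j j∈j)
    }
    where
    _∈_ = restrict R
    at-names : ∀ i j k → (i ∈ j ⊃ i ∈ i) ≡ true × ((i ∈ j ∧ j ∈ k) ⊃ i ∈ k) ≡ true × ((i ∈ j ∧ j ∈ j) ⊃ j ∈ i) ≡ true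
    at-names i j k =
      let e₁ , e  = ∧-elim (i ∈ j ⊃ i ∈ i) _ (⋀-eval R _ (⋀-eval R _ (⋀-eval R _ h i) j) k)
          e₂ , e₃ = ∧-elim ((i ∈ j ∧ j ∈ k) ⊃ i ∈ k) _ e
      in e₁ , e₂ , e₃

  -- The two successors skip the new individuals. Reduction modulo `suc m` makes the assignment
  -- total and fixes the names below the bound.
  old : Name → Fin (3 + m)
  old a = suc (suc (a mod suc m))

  -- Without quantifiers, evaluation never meets the new individuals.
  eval-embed : ∀ R A → AllNames (_< suc m) A → eval (extend (restrict R)) old (embed A) ≡ eval₁ R A
  eval-embed R (ε a b)    (h , k) = cong₂ R (toℕ-mod h) (toℕ-mod k)
    where
    toℕ-mod : ∀ {a} → a < suc m → toℕ (a mod suc m) ≡ a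
    toℕ-mod {a} a<n = trans (toℕ-fromℕ< (m%n<n a (suc m))) (m<n⇒m%n≡m a<n)
  eval-embed R (disj A B) (h , k) = cong₂ _∨_ (eval-embed R A h) (eval-embed R B k)
  eval-embed R (neg A)    h       = cong ∼_ (eval-embed R A h)

L⇒H : ∀ A → ⊢L embed A → ⊢H A
L⇒H A d = mp (valid⇒H m (theory m ⊃ A) (theory-AllNames m , A<n) λ R →
               ⊃-intro (eval₁ R (theory m)) λ h →
                 -- A relation satisfying `theory m` restricts to a model on the names up to `m`;
                 -- soundness in its extension makes `embed A` true there, hence `A` true under `R`.
                 trans (sym (eval-embed m R A A<n))
                       (sound _ (extend-isL₁Model (theory-model m R h)) (extend-split _) d (old m)))
             (theory-provable m)
  where
  m = nameBound A
  A<n = nameBound-bounds A ≤-refl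

theorem6p5 : ((A : L₁Formula) → ⊢L embed A → ⊢H A)
    × ((A : L₁Formula) → ⊢H A → ⊢L embed A)
theorem6p5 = L⇒H , λ A → H⇒L
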